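{- There is a triangle design in $\mathbb{F}_2^6$ which is invariant under a group of $\mathbb{F}_2$-linear automorphisms of $\mathbb{F}_2^6$ isomorphic to the multiplicative group $\mathbb{F}_{32}^*$.
   Context: For a vector space $V$ over $\mathbb{F}_2$, a triangle is a set $\{\langle a,b\rangle,\langle b,c\rangle,\langle c,a\rangle\}$ of three $2$-dimensional subspaces, with $a,b,c$ linearly independent. A triangle design in $V$ is a set of triangles such that every $2$-dimensional subspace of $V$ belongs to exactly one triangle of the set. A design is invariant under a group of linear maps if each map sends the set of triangles onto itself. -}

module Defs where

open import Level using (Level; Lift)
open import Data.Bool using (Bool; true; false; _xor_; _∧_)
open import Data.Vec using (Vec; []; _∷_; zipWith; replicate; map)
open import Data.Nat using (ℕ)
open import Data.Product using (Σ; _×_; _,_)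
open import Data.Sum using (_⊎_)
open import Data.List using (List)
open import Data.List.Membership.Propositional using (_∈_)
open import Relation.Binary.PropositionalEquality using (_≡_)
open import Relation.Nullary using (¬_)

Vecₙ : ℕ → Set
Vecₙ n = Vec Bool n

infixl 6 _+ᵥ_
infixl 7 _·ᵥ_

_+ᵥ_ : ∀ {n} → Vecₙ n → Vecₙ n → Vecₙ n
_+ᵥ_ = zipWith _xor_

0ᵥ : ∀ {n} → Vecₙ n
0ᵥ = replicate _ false

_·ᵥ_ : ∀ {n} → Bool → Vecₙ n → Vecₙ n
s ·ᵥ v = map (s ∧_) v

V : Set
V = Vecₙ 6

Indep2 : V → V → Set
Indep2 a b = ∀ s t → s ·ᵥ a +ᵥ t ·ᵥ b ≡ 0ᵥ → (s ≡ false) × (t ≡ false)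

Indep3 : V → V → V → Set
Indep3 a b c = ∀ s t u → s ·ᵥ a +ᵥ t ·ᵥ b +ᵥ u ·ᵥ c ≡ 0ᵥ →
               (s ≡ false) × (t ≡ false) × (u ≡ false)

VSet : Set₁
VSet = V → Set

_≐_ : VSet → VSet → Set
S ≐ T = ∀ x → (S x → T x) × (T x → S x)

⟨_,_⟩ : V → V → VSet
⟨ a , b ⟩ x = Σ Bool λ s → Σ Bool λ t → x ≡ s ·ᵥ a +ᵥ t ·ᵥ b

img : (V → V) → VSet → VSet
img g S x = Σ V λ y → S y × (g y ≡ x)

Is2Sub : VSet → Set
Is2Sub W = Σ V λ a → Σ V λ b → Indep2 a b × (W ≐ ⟨ a , b ⟩)

-- Triangles: a triple (a,b,c) determines the set of 2-subspaces
-- {⟨a,b⟩, ⟨b,c⟩, ⟨c,a⟩}; it is a triangle when a,b,c are independent.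

Triple : Set
Triple = V × V × V

IsTriangle : Triple → Set
IsTriangle (a , b , c) = Indep3 a b c

VFam : Set₂
VFam = VSet → Set₁

tri : Triple → VFam
tri (a , b , c) W = Lift _ ((W ≐ ⟨ a , b ⟩) ⊎ (W ≐ ⟨ b , c ⟩) ⊎ (W ≐ ⟨ c , a ⟩))

_≋_ : VFam → VFam → Set₁
F ≋ G = ∀ W → (F W → G W) × (G W → F W)

imgF : (V → V) → VFam → VFam
imgF g F W = Σ VSet λ W' → F W' × (W ≐ img g W')

-- Triangle designs. A design is a (finite) set of triangles, given as the
-- set { tri t : t ∈ D } for a list D of triples.

IsTriangleDesign : List Triple → Set₁
IsTriangleDesign D =
  (∀ {t} → t ∈ D → IsTriangle t) ×
  (∀ W → Is2Sub W →
     (Σ Triple λ t → t ∈ D × tri t W) ×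
     (∀ {t t'} → t ∈ D → t' ∈ D → tri t W → tri t' W → tri t ≋ tri t'))

Invariant : (V → V) → List Triple → Set₁
Invariant g D =
  (∀ {t} → t ∈ D → Σ Triple λ t' → t' ∈ D × (imgF g (tri t) ≋ tri t')) ×
  (∀ {t'} → t' ∈ D → Σ Triple λ t → t ∈ D × (imgF g (tri t) ≋ tri t'))

IsLinear : (V → V) → Set
IsLinear g = (∀ x y → g (x +ᵥ y) ≡ g x +ᵥ g y) × (∀ s x → g (s ·ᵥ x) ≡ s ·ᵥ g x)

IsBijective : (V → V) → Set
IsBijective g = Σ (V → V) λ h → (∀ x → h (g x) ≡ x) × (∀ x → g (h x) ≡ x)

-- The field F₃₂ = F₂[X]/(X⁵ + X² + 1)  (X⁵ + X² + 1 is irreducible over F₂).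
-- Elements are coefficient vectors (c₀,…,c₄), low degree first.

F32 : Set
F32 = Vecₙ 5

0F : F32
0F = 0ᵥ

1F : F32
1F = true ∷ false ∷ false ∷ false ∷ false ∷ []

-- multiplication by X, reducing with X⁵ = X² + 1
mulX : F32 → F32
mulX (c0 ∷ c1 ∷ c2 ∷ c3 ∷ c4 ∷ []) = c4 ∷ c0 ∷ (c1 xor c4) ∷ c2 ∷ c3 ∷ []

-- (a₀ + X·a') * v = a₀ v + X (a' * v)
mulAux : ∀ {n} → Vecₙ n → F32 → F32
mulAux []       v = 0F
mulAux (a ∷ as) v = a ·ᵥ v +ᵥ mulX (mulAux as v)

infixl 7 _*F_
_*F_ : F32 → F32 → F32
u *F v = mulAux u v

-- A subgroup G of GL(V) isomorphic to F₃₂*, presented as an injective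
-- group homomorphism φ : F₃₂* → GL(V) (G = image of φ).

IsEmbeddingOfF32* : (F32 → (V → V)) → Set
IsEmbeddingOfF32* φ =
  (∀ u → ¬ (u ≡ 0F) → IsLinear (φ u) × IsBijective (φ u)) ×
  (∀ u v → ¬ (u ≡ 0F) → ¬ (v ≡ 0F) → ∀ x → φ (u *F v) x ≡ φ u (φ v x)) ×
  (∀ u v → ¬ (u ≡ 0F) → ¬ (v ≡ 0F) → (∀ x → φ u x ≡ φ v x) → u ≡ v)

{-# OPTIONS --safe #-}

-- Identify V with F₂ × F₃₂ and let F₃₂* multiply the second coordinate. The 651
-- planes of V form 21 regular orbits, and the 21 sides of the 7 triangles in
-- `base` represent each of them once, so the 7 · 31 translates of `base` form a
-- design. Every plane contains a vector with nonzero second coordinate, so by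
-- invariance it suffices to check the 31 planes through (β , 1) for each β.
module Submission where

open import Defs
open import Data.Bool using (Bool; true; false; _xor_)
import Data.Bool.Properties as 𝔹
open import Data.Empty using (⊥-elim)
open import Data.List using (List; []; _∷_; map; concatMap; cartesianProductWith; filter)
open import Data.List.Membership.Propositional using (_∈_; find; lose)
open import Data.List.Membership.Propositional.Properties
  using (∈-cartesianProductWith⁺; ∈-cartesianProductWith⁻; ∈-concatMap⁺; ∈-concatMap⁻;
         ∈-filter⁺; ∈-filter⁻; ∈-map⁺; ∈-map⁻)
open import Data.List.Relation.Unary.All as All using (All)
open import Data.List.Relation.Unary.Any as Any using (Any; here; there)
open import Data.List.Relation.Unary.Any.Properties using (gmap)
open import Data.Nat using (ℕ; zero; suc)
open import Data.Product using (Σ; ∃; _×_; _,_; proj₁; proj₂)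
open import Data.Product.Properties using () renaming (≡-dec to ×-≡-dec)
open import Data.Sum using (inj₁; inj₂)
open import Data.Unit using (tt)
open import Data.Vec using ([]; _∷_)
open import Data.Vec.Properties
  using (≡-dec; ∷-injective; map-const; map-id; zipWith-assoc; zipWith-comm; zipWith-identityˡ; zipWith-identityʳ)
open import Function using (_∘_; id)
open import Level using (lift)
open import Relation.Binary using (DecidableEquality)
open import Relation.Binary.PropositionalEquality
  using (_≡_; _≢_; refl; sym; trans; cong; cong₂; subst; subst₂; module ≡-Reasoning)
open import Relation.Nullary using (¬_; Dec; yes; no; ¬?)
open import Relation.Nullary.Decidable using (map′; toWitness; _×-dec_; _⊎-dec_; _→-dec_)

-- Decidability by exhausting finite sets

_≟_ : ∀ {n} → DecidableEquality (Vecₙ n)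
_≟_ = ≡-dec 𝔹._≟_

_≟₃_ : DecidableEquality Triple
_≟₃_ = ×-≡-dec _≟_ (×-≡-dec _≟_ _≟_)

allVecs : ∀ n → List (Vecₙ n)
allVecs zero    = [] ∷ []
allVecs (suc n) = cartesianProductWith _∷_ (false ∷ true ∷ []) (allVecs n)

∈-allVecs : ∀ {n} (v : Vecₙ n) → v ∈ allVecs n
∈-allVecs []      = here refl
∈-allVecs (b ∷ v) = ∈-cartesianProductWith⁺ _∷_ (∈-bools b) (∈-allVecs v)
  where
  ∈-bools : ∀ b → b ∈ false ∷ true ∷ []
  ∈-bools false = here refl
  ∈-bools true  = there (here refl)

module _ {n} {p} {P : Vecₙ n → Set p} (P? : ∀ v → Dec (P v)) where

  all-vecs? : Dec (∀ v → P v)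
  all-vecs? = map′ (λ ps v → All.lookup ps (∈-allVecs v)) (λ f → All.tabulate (λ {v} _ → f v))
                   (All.all? P? (allVecs n))

  any-vec? : Dec (∃ P)
  any-vec? = map′ Any.satisfied (λ (v , pv) → lose (∈-allVecs v) pv) (Any.any? P? (allVecs n))

module _ {p} {P : Bool → Set p} (P? : ∀ b → Dec (P b)) where

  all-bools? : Dec (∀ b → P b)
  all-bools? = map′ (λ { (f , t) false → f ; (f , t) true → t }) (λ f → f false , f true)
                    (P? false ×-dec P? true)

  any-bool? : Dec (∃ P)
  any-bool? = map′ (λ { (inj₁ f) → false , f ; (inj₂ t) → true , t })
                   (λ { (false , f) → inj₁ f ; (true , t) → inj₂ t })
                   (P? false ⊎-dec P? true)

-- Vector space laws

+-interchange : ∀ {n} (a b c d : Vecₙ n) → (a +ᵥ b) +ᵥ (c +ᵥ d) ≡ (a +ᵥ c) +ᵥ (b +ᵥ d)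
+-interchange a b c d = begin
  (a +ᵥ b) +ᵥ (c +ᵥ d)  ≡⟨ +-assoc a b (c +ᵥ d) ⟩
  a +ᵥ (b +ᵥ (c +ᵥ d))  ≡⟨ cong (a +ᵥ_) (+-assoc b c d) ⟨
  a +ᵥ ((b +ᵥ c) +ᵥ d)  ≡⟨ cong (λ x → a +ᵥ (x +ᵥ d)) (zipWith-comm 𝔹.xor-comm b c) ⟩
  a +ᵥ ((c +ᵥ b) +ᵥ d)  ≡⟨ cong (a +ᵥ_) (+-assoc c b d) ⟩
  a +ᵥ (c +ᵥ (b +ᵥ d))  ≡⟨ +-assoc a c (b +ᵥ d) ⟨
  (a +ᵥ c) +ᵥ (b +ᵥ d)  ∎
  where
  open ≡-Reasoning
  +-assoc = zipWith-assoc 𝔹.xor-assoc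

0+ : ∀ {n} (v : Vecₙ n) → 0ᵥ +ᵥ v ≡ v
0+ = zipWith-identityˡ 𝔹.xor-identityˡ

+0 : ∀ {n} (v : Vecₙ n) → v +ᵥ 0ᵥ ≡ v
+0 = zipWith-identityʳ 𝔹.xor-identityʳ

0· : ∀ {n} (v : Vecₙ n) → false ·ᵥ v ≡ 0ᵥ
0· v = map-const v false

1· : ∀ {n} (v : Vecₙ n) → true ·ᵥ v ≡ v
1· = map-id

·-distribʳ : ∀ {n} s t (v : Vecₙ n) → (s xor t) ·ᵥ v ≡ s ·ᵥ v +ᵥ t ·ᵥ v
·-distribʳ s t []      = refl
·-distribʳ s t (b ∷ v) = cong₂ _∷_ (𝔹.∧-distribʳ-xor b s t) (·-distribʳ s t v)

·-distribˡ : ∀ {n} s (v w : Vecₙ n) → s ·ᵥ (v +ᵥ w) ≡ s ·ᵥ v +ᵥ s ·ᵥ w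
·-distribˡ s []      []      = refl
·-distribˡ s (a ∷ v) (b ∷ w) = cong₂ _∷_ (𝔹.∧-distribˡ-xor s a b) (·-distribˡ s v w)

-- The only scalars are 0 and 1.
fixes-0⇒homogeneous : ∀ {m n} (f : Vecₙ m → Vecₙ n) → f 0ᵥ ≡ 0ᵥ → ∀ s v → f (s ·ᵥ v) ≡ s ·ᵥ f v
fixes-0⇒homogeneous f f0 false v = trans (cong f (0· v)) (trans f0 (sym (0· (f v))))
fixes-0⇒homogeneous f f0 true  v = trans (cong f (1· v)) (sym (1· (f v)))

-- Arithmetic in F₃₂

mulX-+ : ∀ v w → mulX (v +ᵥ w) ≡ mulX v +ᵥ mulX w
mulX-+ (v₀ ∷ v₁ ∷ v₂ ∷ v₃ ∷ v₄ ∷ []) (w₀ ∷ w₁ ∷ w₂ ∷ w₃ ∷ w₄ ∷ []) =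
  cong (λ b → (v₄ xor w₄) ∷ (v₀ xor w₀) ∷ b ∷ (v₂ xor w₂) ∷ (v₃ xor w₃) ∷ [])
       -- Only the coefficient of X² has two summands, because X⁵ reduces to X² + 1. One-bit vectors
       -- let `+-interchange` regroup it.
       (cong (λ { (b ∷ []) → b }) (+-interchange (v₁ ∷ []) (w₁ ∷ []) (v₄ ∷ []) (w₄ ∷ [])))

mulAux-distribˡ : ∀ {n} (as : Vecₙ n) v w → mulAux as (v +ᵥ w) ≡ mulAux as v +ᵥ mulAux as w
mulAux-distribˡ []       v w = refl
mulAux-distribˡ (a ∷ as) v w = begin
  a ·ᵥ (v +ᵥ w) +ᵥ mulX (mulAux as (v +ᵥ w))
    ≡⟨ cong₂ _+ᵥ_ (·-distribˡ a v w) (trans (cong mulX (mulAux-distribˡ as v w)) (mulX-+ _ _)) ⟩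
  (a ·ᵥ v +ᵥ a ·ᵥ w) +ᵥ (mulX (mulAux as v) +ᵥ mulX (mulAux as w))
    ≡⟨ +-interchange (a ·ᵥ v) _ _ _ ⟩
  (a ·ᵥ v +ᵥ mulX (mulAux as v)) +ᵥ (a ·ᵥ w +ᵥ mulX (mulAux as w)) ∎
  where open ≡-Reasoning

mulAux-distribʳ : ∀ {n} (as bs : Vecₙ n) v → mulAux (as +ᵥ bs) v ≡ mulAux as v +ᵥ mulAux bs v
mulAux-distribʳ []       []       v = refl
mulAux-distribʳ (a ∷ as) (b ∷ bs) v = begin
  (a xor b) ·ᵥ v +ᵥ mulX (mulAux (as +ᵥ bs) v)
    ≡⟨ cong₂ _+ᵥ_ (·-distribʳ a b v) (trans (cong mulX (mulAux-distribʳ as bs v)) (mulX-+ _ _)) ⟩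
  (a ·ᵥ v +ᵥ b ·ᵥ v) +ᵥ (mulX (mulAux as v) +ᵥ mulX (mulAux bs v))
    ≡⟨ +-interchange (a ·ᵥ v) _ _ _ ⟩
  (a ·ᵥ v +ᵥ mulX (mulAux as v)) +ᵥ (b ·ᵥ v +ᵥ mulX (mulAux bs v)) ∎
  where open ≡-Reasoning

opaque
  *-zeroˡ : ∀ v → 0F *F v ≡ 0F
  *-zeroˡ = toWitness {a? = all-vecs? λ v → (0F *F v) ≟ 0F} tt

  *-zeroʳ : ∀ u → u *F 0F ≡ 0F
  *-zeroʳ = toWitness {a? = all-vecs? λ u → (u *F 0F) ≟ 0F} tt

  *-identityˡ : ∀ v → 1F *F v ≡ v
  *-identityˡ = toWitness {a? = all-vecs? λ v → (1F *F v) ≟ v} tt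

  *-identityʳ : ∀ u → u *F 1F ≡ u
  *-identityʳ = toWitness {a? = all-vecs? λ u → (u *F 1F) ≟ u} tt

  mulX-* : ∀ u v → mulX u *F v ≡ mulX (u *F v)
  mulX-* = toWitness {a? = all-vecs? λ u → all-vecs? λ v → (mulX u *F v) ≟ mulX (u *F v)} tt

  -- The success of this search for every nonzero `u` amounts to irreducibility of the modulus. Both
  -- orders are recorded: one makes `φ v` a left inverse of `φ u`, the other a right inverse.
  inverse : ∀ u → u ≢ 0F → ∃ λ v → u *F v ≡ 1F × v *F u ≡ 1F
  inverse = toWitness {a? = all-vecs? λ u → ¬? (u ≟ 0F) →-dec
    any-vec? λ v → ((u *F v) ≟ 1F) ×-dec ((v *F u) ≟ 1F)} tt

-- Horner's scheme reduces associativity to the case (X u) v = X (u v), which is `mulX-*`. So a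
-- check of 1024 pairs and an induction on coefficients replace a check of 32768 triples. The length
-- `n` is arbitrary because the induction strips coefficients.
mulAux-* : ∀ {n} (as : Vecₙ n) v w → mulAux as v *F w ≡ mulAux as (v *F w)
mulAux-* []       v w = *-zeroˡ w
mulAux-* (a ∷ as) v w = begin
  (a ·ᵥ v +ᵥ mulX (mulAux as v)) *F w
    ≡⟨ mulAux-distribʳ (a ·ᵥ v) _ w ⟩
  (a ·ᵥ v) *F w +ᵥ mulX (mulAux as v) *F w
    ≡⟨ cong₂ _+ᵥ_ (fixes-0⇒homogeneous (_*F w) (*-zeroˡ w) a v) (mulX-* (mulAux as v) w) ⟩
  a ·ᵥ (v *F w) +ᵥ mulX (mulAux as v *F w)
    ≡⟨ cong (λ x → a ·ᵥ (v *F w) +ᵥ mulX x) (mulAux-* as v w) ⟩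
  a ·ᵥ (v *F w) +ᵥ mulX (mulAux as (v *F w)) ∎
  where open ≡-Reasoning

*-assoc : ∀ u v w → (u *F v) *F w ≡ u *F (v *F w)
*-assoc = mulAux-*

0≢1 : 0F ≢ 1F
0≢1 ()

leftInverse⇒≢0 : ∀ {u v} → u *F v ≡ 1F → u ≢ 0F
leftInverse⇒≢0 {v = v} uv≡1 u≡0 = 0≢1 (trans (sym (*-zeroˡ v)) (trans (cong (_*F v) (sym u≡0)) uv≡1))

*-≢0 : ∀ {u v} → u ≢ 0F → v ≢ 0F → u *F v ≢ 0F
*-≢0 {u} {v} u≢0 v≢0 uv≡0 with u⁻¹ , _ , u⁻¹u≡1 ← inverse u u≢0 = v≢0 (begin
  v                ≡⟨ *-identityˡ v ⟨
  1F *F v          ≡⟨ cong (_*F v) u⁻¹u≡1 ⟨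
  (u⁻¹ *F u) *F v  ≡⟨ *-assoc u⁻¹ u v ⟩
  u⁻¹ *F (u *F v)  ≡⟨ cong (u⁻¹ *F_) uv≡0 ⟩
  u⁻¹ *F 0F        ≡⟨ *-zeroʳ u⁻¹ ⟩
  0F               ∎)
  where open ≡-Reasoning

-- Spans and linear maps

≐-sym : ∀ {S T} → S ≐ T → T ≐ S
≐-sym S≐T x = proj₂ (S≐T x) , proj₁ (S≐T x)

≐-trans : ∀ {S T U} → S ≐ T → T ≐ U → S ≐ U
≐-trans S≐T T≐U x = proj₁ (T≐U x) ∘ proj₁ (S≐T x) , proj₂ (S≐T x) ∘ proj₂ (T≐U x)

span-genˡ : ∀ a b → ⟨ a , b ⟩ a
span-genˡ a b = true , false , sym (trans (cong₂ _+ᵥ_ (1· a) (0· b)) (+0 a))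

span-genʳ : ∀ a b → ⟨ a , b ⟩ b
span-genʳ a b = false , true , sym (trans (cong₂ _+ᵥ_ (0· a) (1· b)) (0+ b))

span-0 : ∀ a b → ⟨ a , b ⟩ 0ᵥ
span-0 a b = false , false , sym (trans (cong₂ _+ᵥ_ (0· a) (0· b)) (0+ 0ᵥ))

span-+ : ∀ {a b x y} → ⟨ a , b ⟩ x → ⟨ a , b ⟩ y → ⟨ a , b ⟩ (x +ᵥ y)
span-+ {a} {b} (s , t , refl) (s' , t' , refl) = s xor s' , t xor t' ,
  trans (+-interchange (s ·ᵥ a) _ _ _) (sym (cong₂ _+ᵥ_ (·-distribʳ s s' a) (·-distribʳ t t' b)))

span-· : ∀ {a b x} s → ⟨ a , b ⟩ x → ⟨ a , b ⟩ (s ·ᵥ x)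
span-· {a} {b} {x} false _  = subst ⟨ a , b ⟩ (sym (0· x)) (span-0 a b)
span-· {a} {b} {x} true  x∈ = subst ⟨ a , b ⟩ (sym (1· x)) x∈

span-⊆ : ∀ {a b c d} → ⟨ c , d ⟩ a → ⟨ c , d ⟩ b → ∀ {x} → ⟨ a , b ⟩ x → ⟨ c , d ⟩ x
span-⊆ a∈ b∈ (s , t , refl) = span-+ (span-· s a∈) (span-· t b∈)

span-≐ : ∀ {a b c d} → (⟨ c , d ⟩ a × ⟨ c , d ⟩ b) × (⟨ a , b ⟩ c × ⟨ a , b ⟩ d) → ⟨ a , b ⟩ ≐ ⟨ c , d ⟩
span-≐ ((a∈ , b∈) , (c∈ , d∈)) x = span-⊆ a∈ b∈ , span-⊆ c∈ d∈

span-gens : ∀ {a b c d} → ⟨ a , b ⟩ ≐ ⟨ c , d ⟩ → (⟨ c , d ⟩ a × ⟨ c , d ⟩ b) × (⟨ a , b ⟩ c × ⟨ a , b ⟩ d)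
span-gens {a} {b} {c} {d} eq =
  (proj₁ (eq a) (span-genˡ a b) , proj₁ (eq b) (span-genʳ a b)) ,
  (proj₂ (eq c) (span-genˡ c d) , proj₂ (eq d) (span-genʳ c d))

span-swap : ∀ a b → ⟨ a , b ⟩ ≐ ⟨ b , a ⟩
span-swap a b = span-≐ ((span-genʳ b a , span-genˡ b a) , (span-genʳ a b , span-genˡ a b))

_∈span?_ : ∀ x ((a , b) : V × V) → Dec (⟨ a , b ⟩ x)
x ∈span? (a , b) = any-bool? λ s → any-bool? λ t → x ≟ (s ·ᵥ a +ᵥ t ·ᵥ b)

-- Two spans agree exactly when each contains the generators of the other. Comparison thus costs
-- four searches over pairs of scalars instead of a sweep through all of `V`.
_≐?_ : ((a , b) (c , d) : V × V) → Dec (⟨ a , b ⟩ ≐ ⟨ c , d ⟩)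
(a , b) ≐? (c , d) = map′ span-≐ span-gens
  (((a ∈span? (c , d)) ×-dec (b ∈span? (c , d))) ×-dec ((c ∈span? (a , b)) ×-dec (d ∈span? (a , b))))

+-self : ∀ {n} (v : Vecₙ n) → v +ᵥ v ≡ 0ᵥ
+-self v = begin
  v +ᵥ v                        ≡⟨ cong₂ _+ᵥ_ (1· v) (1· v) ⟨
  true ·ᵥ v +ᵥ true ·ᵥ v        ≡⟨ ·-distribʳ true true v ⟨
  false ·ᵥ v                    ≡⟨ 0· v ⟩
  0ᵥ                            ∎
  where open ≡-Reasoning

true≢false : true ≢ false
true≢false ()

-- Over F₂ the nontrivial scalar pairs are (1,0), (0,1) and (1,1); each yields one of the three
-- inequalities.
indep-distinct : ∀ {a b} → Indep2 a b → a ≢ 0ᵥ × b ≢ 0ᵥ × b ≢ a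
indep-distinct {a} {b} ind =
    (λ { refl → true≢false (proj₁ (ind true false (trans (cong₂ _+ᵥ_ (1· 0ᵥ) (0· b)) (0+ 0ᵥ)))) })
  , (λ { refl → true≢false (proj₂ (ind false true (trans (cong₂ _+ᵥ_ (0· a) (1· 0ᵥ)) (0+ 0ᵥ)))) })
  , (λ { refl → true≢false (proj₁ (ind true true (trans (cong₂ _+ᵥ_ (1· a) (1· a)) (+-self a)))) })

indep3? : ∀ a b c → Dec (Indep3 a b c)
indep3? a b c = all-bools? λ s → all-bools? λ t → all-bools? λ u →
  ((s ·ᵥ a +ᵥ t ·ᵥ b +ᵥ u ·ᵥ c) ≟ 0ᵥ) →-dec ((s 𝔹.≟ false) ×-dec (t 𝔹.≟ false) ×-dec (u 𝔹.≟ false))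

-- Sides of triangles and their images under linear maps

sides : Triple → List (V × V)
sides (a , b , c) = (a , b) ∷ (b , c) ∷ (c , a) ∷ []

-- Counterpart of `tri` in `Set`. As an `Any` over a list it can be opened by `find`, rebuilt by
-- `lose` and transported by `gmap`.
HasSide : VSet → Triple → Set
HasSide W t = Any (λ (a , b) → W ≐ ⟨ a , b ⟩) (sides t)

tri⇒HasSide : ∀ {W} t → tri t W → HasSide W t
tri⇒HasSide _ (lift (inj₁ w))        = here w
tri⇒HasSide _ (lift (inj₂ (inj₁ w))) = there (here w)
tri⇒HasSide _ (lift (inj₂ (inj₂ w))) = there (there (here w))

HasSide⇒tri : ∀ {W} t → HasSide W t → tri t W
HasSide⇒tri _ (here w)                 = lift (inj₁ w)
HasSide⇒tri _ (there (here w))         = lift (inj₂ (inj₁ w))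
HasSide⇒tri _ (there (there (here w))) = lift (inj₂ (inj₂ w))

HasSide-resp : ∀ {W W'} t → W ≐ W' → HasSide W' t → HasSide W t
HasSide-resp _ W≐W' = Any.map (≐-trans W≐W')

mapTriple : (V → V) → Triple → Triple
mapTriple g (a , b , c) = g a , g b , g c

module _ {g : V → V} (g-linear : IsLinear g) where

  open Σ g-linear renaming (proj₁ to g-+; proj₂ to g-·)

  g-combination : ∀ s a t b → g (s ·ᵥ a +ᵥ t ·ᵥ b) ≡ s ·ᵥ g a +ᵥ t ·ᵥ g b
  g-combination s a t b = trans (g-+ _ _) (cong₂ _+ᵥ_ (g-· s a) (g-· t b))

  span-map : ∀ {a b x} → ⟨ a , b ⟩ x → ⟨ g a , g b ⟩ (g x)
  span-map {a} {b} (s , t , refl) = s , t , g-combination s a t b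

  span-≐-map : ∀ {a b c d} → ⟨ a , b ⟩ ≐ ⟨ c , d ⟩ → ⟨ g a , g b ⟩ ≐ ⟨ g c , g d ⟩
  span-≐-map eq with (a∈ , b∈) , (c∈ , d∈) ← span-gens eq =
    span-≐ ((span-map a∈ , span-map b∈) , (span-map c∈ , span-map d∈))

  HasSide-map : ∀ {a b} t → HasSide ⟨ a , b ⟩ t → HasSide ⟨ g a , g b ⟩ (mapTriple g t)
  HasSide-map _ = gmap span-≐-map

  img-span : ∀ {W a b} → W ≐ ⟨ a , b ⟩ → img g W ≐ ⟨ g a , g b ⟩
  img-span {a = a} {b} eq x =
    (λ { (y , y∈ , refl) → span-map (proj₁ (eq y) y∈) }) ,
    (λ { (s , t , refl) → s ·ᵥ a +ᵥ t ·ᵥ b , proj₂ (eq _) (s , t , refl) , g-combination s a t b })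

  imgF-tri : ∀ t → imgF g (tri t) ≋ tri (mapTriple g t)
  imgF-tri t W =
    (λ (W' , w' , eq) → HasSide⇒tri (mapTriple g t)
       (gmap (λ w → ≐-trans eq (img-span w)) (tri⇒HasSide t w'))) ,
    (λ w → preimage (tri⇒HasSide (mapTriple g t) w))
    where
    ≐-refl : ∀ {S} → S ≐ S
    ≐-refl x = id , id
    -- The source plane is the corresponding side of `t` itself, whose image `img-span` computes.
    preimage : HasSide W (mapTriple g t) → imgF g (tri t) W
    preimage (here w) =
      _ , HasSide⇒tri t (here ≐-refl) , ≐-trans w (≐-sym (img-span ≐-refl))
    preimage (there (here w)) =
      _ , HasSide⇒tri t (there (here ≐-refl)) , ≐-trans w (≐-sym (img-span ≐-refl))
    preimage (there (there (here w))) =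
      _ , HasSide⇒tri t (there (there (here ≐-refl))) , ≐-trans w (≐-sym (img-span ≐-refl))

  -- A linear relation among the images is the image of the same relation among the original
  -- vectors, and the trivial kernel pulls it back.
  IsTriangle-map : ∀ t → (∀ x → g x ≡ 0ᵥ → x ≡ 0ᵥ) → IsTriangle t → IsTriangle (mapTriple g t)
  IsTriangle-map (a , b , c) kernel ind s t u eq = ind s t u (kernel _
    (trans (trans (g-+ _ _) (cong₂ _+ᵥ_ (g-combination s a t b) (g-· u c))) eq))

-- The group action and the design

φ : F32 → V → V
φ u (b ∷ x) = b ∷ u *F x

φ-linear : ∀ u → IsLinear (φ u)
φ-linear u = φ-+ , fixes-0⇒homogeneous (φ u) (cong (false ∷_) (*-zeroʳ u))
  where
  φ-+ : ∀ x y → φ u (x +ᵥ y) ≡ φ u x +ᵥ φ u y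
  φ-+ (b ∷ x) (c ∷ y) = cong ((b xor c) ∷_) (mulAux-distribˡ u x y)

φ-* : ∀ u v x → φ (u *F v) x ≡ φ u (φ v x)
φ-* u v (b ∷ x) = cong (b ∷_) (*-assoc u v x)

φ-1 : ∀ x → φ 1F x ≡ x
φ-1 (b ∷ x) = cong (b ∷_) (*-identityˡ x)

φ-cancel : ∀ {u v} → u *F v ≡ 1F → ∀ x → φ u (φ v x) ≡ x
φ-cancel {u} {v} uv≡1 x = trans (sym (φ-* u v x)) (trans (cong (λ w → φ w x) uv≡1) (φ-1 x))

φ-injective : ∀ {u} → u ≢ 0F → ∀ {x y} → φ u x ≡ φ u y → x ≡ y
φ-injective {u} u≢0 {x} {y} eq with u⁻¹ , _ , u⁻¹u≡1 ← inverse u u≢0 =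
  trans (sym (φ-cancel u⁻¹u≡1 x)) (trans (cong (φ u⁻¹) eq) (φ-cancel u⁻¹u≡1 y))

φ-0ᵥ : ∀ u → φ u 0ᵥ ≡ 0ᵥ
φ-0ᵥ u = cong (false ∷_) (*-zeroʳ u)

φ-embedding : IsEmbeddingOfF32* φ
φ-embedding = (λ u u≢0 → φ-linear u , bijective u u≢0) , (λ u v _ _ → φ-* u v) , faithful
  where
  bijective : ∀ u → u ≢ 0F → IsBijective (φ u)
  bijective u u≢0 with u⁻¹ , uu⁻¹≡1 , u⁻¹u≡1 ← inverse u u≢0 =
    φ u⁻¹ , φ-cancel u⁻¹u≡1 , φ-cancel uu⁻¹≡1
  faithful : ∀ u v → u ≢ 0F → v ≢ 0F → (∀ x → φ u x ≡ φ v x) → u ≡ v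
  -- Evaluation at a vector with second coordinate 1 recovers the multiplier.
  faithful u v _ _ eq = trans (sym (*-identityʳ u))
    (trans (proj₂ (∷-injective (eq (false ∷ 1F)))) (*-identityʳ v))

act : F32 → Triple → Triple
act u = mapTriple (φ u)

triple-≡ : ∀ {a a' b b' c c' : V} → a ≡ a' → b ≡ b' → c ≡ c' → (a , b , c) ≡ (a' , b' , c')
triple-≡ refl refl refl = refl

act-* : ∀ u v t → act (u *F v) t ≡ act u (act v t)
act-* u v (a , b , c) = triple-≡ (φ-* u v a) (φ-* u v b) (φ-* u v c)

act-cancel : ∀ {u v} → u *F v ≡ 1F → ∀ t → act u (act v t) ≡ t
act-cancel uv≡1 (a , b , c) = triple-≡ (φ-cancel uv≡1 a) (φ-cancel uv≡1 b) (φ-cancel uv≡1 c)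

-- The group F₃₂* has prime order 31, so X generates it and every nonzero element is such a power.
X^_ : ℕ → F32
X^ zero  = 1F
X^ suc k = mulX (X^ k)

-- Found by computer search.
base : List Triple
base =
  (false ∷ X^ 0 , false ∷ X^ 1  , true ∷ X^ 0) ∷
  (false ∷ X^ 0 , false ∷ X^ 3  , true ∷ X^ 1) ∷
  (false ∷ X^ 0 , false ∷ X^ 8  , true ∷ X^ 2) ∷
  (false ∷ X^ 3 , false ∷ X^ 7  , true ∷ X^ 0) ∷
  (false ∷ X^ 4 , false ∷ X^ 11 , true ∷ X^ 0) ∷
  (false ∷ X^ 0 , true  ∷ X^ 4  , true ∷ X^ 11) ∷
  (false ∷ X^ 9 , true  ∷ X^ 0  , true ∷ X^ 1) ∷ []

units : List F32
units = filter (λ u → ¬? (u ≟ 0F)) (allVecs 5)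

opaque
  design : List Triple
  design = cartesianProductWith act units base

  design⁺ : ∀ {u t} → u ≢ 0F → t ∈ base → act u t ∈ design
  design⁺ u≢0 = ∈-cartesianProductWith⁺ act (∈-filter⁺ (λ u → ¬? (u ≟ 0F)) (∈-allVecs _) u≢0)

  design⁻ : ∀ {t} → t ∈ design → ∃ λ u → ∃ λ t₀ → u ≢ 0F × t₀ ∈ base × t ≡ act u t₀
  design⁻ t∈ with u , t₀ , u∈ , t₀∈ , eq ← ∈-cartesianProductWith⁻ act units base t∈ =
    u , t₀ , proj₂ (∈-filter⁻ (λ u → ¬? (u ≟ 0F)) {xs = allVecs 5} u∈) , t₀∈ , eq

-- The translate by `v` becomes the translate by `u *F v`, which is nonzero because F₃₂ has no zero
-- divisors.
design-act : ∀ {u t} → u ≢ 0F → t ∈ design → act u t ∈ design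
design-act {u} u≢0 t∈ with v , t₀ , v≢0 , t₀∈ , refl ← design⁻ t∈ =
  subst (_∈ design) (act-* u v t₀) (design⁺ (*-≢0 u≢0 v≢0) t₀∈)

-- Finite checks on the base triangles and on planes through `β ∷ 1F`

opaque
  base-triangles : All IsTriangle base
  base-triangles = toWitness {a? = All.all? (λ (a , b , c) → indep3? a b c) base} tt

-- An incidence between a triangle and one of its sides. The side is kept as a generating pair, so
-- that `_≐?_` applies to it.
Flag : Set
Flag = Triple × (V × V)

opaque
  unfolding design

  flags : List Flag
  flags = concatMap (λ t → map (t ,_) (sides t)) design

  -- A side equal to a plane through `a` must itself contain `a`. For nonzero `a` this leaves 31 of
  -- the 651 flags to inspect.
  star : V → List Flag
  star a = filter (λ (_ , p) → a ∈span? p) flags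

  ∈-star⁺ : ∀ {a t c d} → t ∈ design → (c , d) ∈ sides t → ⟨ c , d ⟩ a → (t , (c , d)) ∈ star a
  ∈-star⁺ {a} {t} t∈ p∈ = ∈-filter⁺ (λ (_ , p) → a ∈span? p)
    (∈-concatMap⁺ (λ t → map (t ,_) (sides t)) (lose t∈ (∈-map⁺ (t ,_) p∈)))

  ∈-star⁻ : ∀ {a t p} → (t , p) ∈ star a → t ∈ design × p ∈ sides t
  ∈-star⁻ {a} f∈
    with t , t∈ , f∈t ← find (∈-concatMap⁻ (λ t → map (t ,_) (sides t)) {xs = design}
                                (proj₁ (∈-filter⁻ (λ (_ , p) → a ∈span? p) f∈)))
    with p , p∈ , refl ← ∈-map⁻ (t ,_) f∈t = t∈ , p∈

-- For nonzero `a`, the excluded values of `b` are those for which `a` and `b` span no plane. Each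
-- plane through `a` then occurs twice, from `b` and from `a +ᵥ b`.
CoversPlanesThrough : V → List Flag → Set
CoversPlanesThrough a fs = ∀ b → b ≢ 0ᵥ → b ≢ a → Any (λ (_ , (c , d)) → ⟨ a , b ⟩ ≐ ⟨ c , d ⟩) fs

coversPlanesThrough? : ∀ a fs → Dec (CoversPlanesThrough a fs)
coversPlanesThrough? a fs = all-vecs? λ b → ¬? (b ≟ 0ᵥ) →-dec (¬? (b ≟ a) →-dec
  Any.any? (λ (_ , p) → (a , b) ≐? p) fs)

-- Uniqueness is strengthened from equality of families of planes to equality of triples, which
-- `_≟₃_` decides and which passes through `act`.
SideDeterminesTriple : List Flag → Set
SideDeterminesTriple fs =
  All (λ (t , (a , b)) → All (λ (t' , (c , d)) → ⟨ a , b ⟩ ≐ ⟨ c , d ⟩ → t ≡ t') fs) fs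

sideDeterminesTriple? : ∀ fs → Dec (SideDeterminesTriple fs)
sideDeterminesTriple? fs = All.all? (λ (t , p) → All.all? (λ (t' , p') → (p ≐? p') →-dec (t ≟₃ t')) fs) fs

-- The deciders receive the star as an argument so that it is computed only once.
opaque
  unfolding star

  star-covers : ∀ β → CoversPlanesThrough (β ∷ 1F) (star (β ∷ 1F))
  star-covers = toWitness {a? = all-bools? λ β → coversPlanesThrough? (β ∷ 1F) (star (β ∷ 1F))} tt

  star-determines : ∀ β → SideDeterminesTriple (star (β ∷ 1F))
  star-determines = toWitness {a? = all-bools? λ β → sideDeterminesTriple? (star (β ∷ 1F))} tt

-- Transfer from the checked cases to all triangles and planes

design-triangles : ∀ {t} → t ∈ design → IsTriangle t
design-triangles t∈ with u , t₀ , u≢0 , t₀∈ , refl ← design⁻ t∈ =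
  IsTriangle-map (φ-linear u) t₀ (λ x eq → φ-injective u≢0 (trans eq (sym (φ-0ᵥ u))))
    (All.lookup base-triangles t₀∈)

UniquelyCovered : VSet → Set
UniquelyCovered W =
  (∃ λ t → t ∈ design × HasSide W t) ×
  (∀ {t t'} → t ∈ design → t' ∈ design → HasSide W t → HasSide W t' → t ≡ t')

UniquelyCovered-resp : ∀ {W W'} → W ≐ W' → UniquelyCovered W' → UniquelyCovered W
UniquelyCovered-resp eq ((t , t∈ , h) , unique) =
  (t , t∈ , HasSide-resp t eq h) ,
  λ {t} {t'} t∈ t'∈ h h' → unique t∈ t'∈ (HasSide-resp t (≐-sym eq) h) (HasSide-resp t' (≐-sym eq) h')

-- For existence, a covering triple is carried back by the inverse of `u`. For uniqueness, both
-- candidates are carried forward by `u`, identified there, and the action is cancelled.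
UniquelyCovered-φ : ∀ {u a b} → u ≢ 0F →
  UniquelyCovered ⟨ φ u a , φ u b ⟩ → UniquelyCovered ⟨ a , b ⟩
UniquelyCovered-φ {u} {a} {b} u≢0 ((t , t∈ , h) , unique)
  with u⁻¹ , uu⁻¹≡1 , u⁻¹u≡1 ← inverse u u≢0 =
  (act u⁻¹ t , design-act (leftInverse⇒≢0 u⁻¹u≡1) t∈ ,
    subst₂ (λ x y → HasSide ⟨ x , y ⟩ (act u⁻¹ t)) (φ-cancel u⁻¹u≡1 a) (φ-cancel u⁻¹u≡1 b)
      (HasSide-map (φ-linear u⁻¹) t h)) ,
  λ {t} {t'} t∈ t'∈ h h' → trans (sym (act-cancel u⁻¹u≡1 t)) (trans
    (cong (act u⁻¹) (unique (design-act u≢0 t∈) (design-act u≢0 t'∈)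
      (HasSide-map (φ-linear u) t h) (HasSide-map (φ-linear u) t' h')))
    (act-cancel u⁻¹u≡1 t'))

uniquelyCovered-1 : ∀ {β b} → b ≢ 0ᵥ → b ≢ β ∷ 1F → UniquelyCovered ⟨ β ∷ 1F , b ⟩
uniquelyCovered-1 {β} {b} b≢0 b≢a = exists , unique
  where
  exists : ∃ λ t → t ∈ design × HasSide ⟨ β ∷ 1F , b ⟩ t
  exists with (t , p) , f∈ , eq ← find (star-covers β b b≢0 b≢a)
    with t∈ , p∈ ← ∈-star⁻ f∈ = t , t∈ , lose p∈ eq
  unique : ∀ {t t'} → t ∈ design → t' ∈ design →
    HasSide ⟨ β ∷ 1F , b ⟩ t → HasSide ⟨ β ∷ 1F , b ⟩ t' → t ≡ t'
  -- Both sides equal the plane and so contain `β ∷ 1F`; their flags therefore lie in the star that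
  -- was checked.
  unique t∈ t'∈ h h' with p , p∈ , eq ← find h with p' , p'∈ , eq' ← find h' =
    All.lookup (All.lookup (star-determines β) (∈-star⁺ t∈ p∈ (proj₁ (eq _) (span-genˡ _ b))))
      (∈-star⁺ t'∈ p'∈ (proj₁ (eq' _) (span-genˡ _ b))) (≐-trans (≐-sym eq) eq')

-- Scaling by the inverse of `x` normalises the first generator to `β ∷ 1F`; injectivity keeps the
-- second one nonzero and distinct from it.
uniquelyCovered-nonzero : ∀ {β x b} → x ≢ 0F → b ≢ 0ᵥ → b ≢ β ∷ x → UniquelyCovered ⟨ β ∷ x , b ⟩
uniquelyCovered-nonzero {β} {x} {b} x≢0 b≢0 b≢a with x⁻¹ , xx⁻¹≡1 , x⁻¹x≡1 ← inverse x x≢0 =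
  UniquelyCovered-φ x⁻¹≢0 (subst (λ a → UniquelyCovered ⟨ a , φ x⁻¹ b ⟩) (sym φa≡1)
    (uniquelyCovered-1
      (λ eq → b≢0 (φ-injective x⁻¹≢0 (trans eq (sym (φ-0ᵥ x⁻¹)))))
      (λ eq → b≢a (φ-injective x⁻¹≢0 (trans eq (sym φa≡1))))))
  where
  x⁻¹≢0 : x⁻¹ ≢ 0F
  x⁻¹≢0 = leftInverse⇒≢0 x⁻¹x≡1
  φa≡1 : φ x⁻¹ (β ∷ x) ≡ β ∷ 1F
  φa≡1 = cong (β ∷_) x⁻¹x≡1

-- A plane cannot be spanned by vectors whose F₃₂-coordinates both vanish.
uniquelyCovered : ∀ a b → a ≢ 0ᵥ → b ≢ 0ᵥ → b ≢ a → UniquelyCovered ⟨ a , b ⟩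
uniquelyCovered (β ∷ x) (γ ∷ y) a≢0 b≢0 b≢a with x ≟ 0F | y ≟ 0F
... | no x≢0   | _      = uniquelyCovered-nonzero x≢0 b≢0 b≢a
... | yes refl | no y≢0 = UniquelyCovered-resp (span-swap (β ∷ x) (γ ∷ y))
  (uniquelyCovered-nonzero y≢0 a≢0 (b≢a ∘ sym))
uniquelyCovered (false ∷ _) _           a≢0 _ _   | yes refl | yes refl = ⊥-elim (a≢0 refl)
uniquelyCovered (true ∷ _)  (false ∷ _) _ b≢0 _   | yes refl | yes refl = ⊥-elim (b≢0 refl)
uniquelyCovered (true ∷ _)  (true ∷ _)  _ _   b≢a | yes refl | yes refl = ⊥-elim (b≢a refl)

-- The design property and invariance

design-isTriangleDesign : IsTriangleDesign design
design-isTriangleDesign = design-triangles , λ W plane → exists plane , unique plane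
  where
  covered : ∀ {W} → Is2Sub W → UniquelyCovered W
  covered (a , b , ind , W≐) with a≢0 , b≢0 , b≢a ← indep-distinct ind =
    UniquelyCovered-resp W≐ (uniquelyCovered a b a≢0 b≢0 b≢a)
  exists : ∀ {W} → Is2Sub W → Σ Triple λ t → t ∈ design × tri t W
  exists plane with (t , t∈ , h) , _ ← covered plane = t , t∈ , HasSide⇒tri t h
  unique : ∀ {W} → Is2Sub W → ∀ {t t'} → t ∈ design → t' ∈ design → tri t W → tri t' W → tri t ≋ tri t'
  unique plane {t} {t'} t∈ t'∈ w w'
    with refl ← proj₂ (covered plane) t∈ t'∈ (tri⇒HasSide t w) (tri⇒HasSide t' w') = λ W → id , id

design-invariant : ∀ u → u ≢ 0F → Invariant (φ u) design
design-invariant u u≢0 = image , preimage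
  where
  image : ∀ {t} → t ∈ design → Σ Triple λ t' → t' ∈ design × (imgF (φ u) (tri t) ≋ tri t')
  image {t} t∈ = act u t , design-act u≢0 t∈ , imgF-tri (φ-linear u) t
  preimage : ∀ {t'} → t' ∈ design → Σ Triple λ t → t ∈ design × (imgF (φ u) (tri t) ≋ tri t')
  preimage {t'} t'∈ with u⁻¹ , uu⁻¹≡1 , u⁻¹u≡1 ← inverse u u≢0 =
    act u⁻¹ t' , design-act (leftInverse⇒≢0 u⁻¹u≡1) t'∈ ,
    -- `imgF-tri` yields the triangle of `act u (act u⁻¹ t')`, and cancellation turns this triple
    -- into `t'`.
    subst (λ t → imgF (φ u) (tri (act u⁻¹ t')) ≋ tri t) (act-cancel uu⁻¹≡1 t')
      (imgF-tri (φ-linear u) (act u⁻¹ t'))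

theorem1 : Σ (List Triple) λ D → Σ (F32 → (V → V)) λ φ →
    IsTriangleDesign D × IsEmbeddingOfF32* φ ×
    (∀ u → ¬ (u ≡ 0F) → Invariant (φ u) D)
theorem1 = design , φ , design-isTriangleDesign , φ-embedding , design-invariant
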